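{- For every integer $k\ge2$, there exist $k$-growth systems that are not $k$-circuit bounded.
   Context: An independence system $(S,\mathcal{I})$ is a finite set $S$ with a nonempty downward-closed family $\mathcal{I}\subseteq2^S$ of independent sets. Circuits are the inclusion-wise minimal non-independent sets. A basis of $X\subseteq S$ is an inclusion-wise maximal independent subset of $X$. $k$-growth: for all $X\subseteq S$ and all $I\in\mathcal{I}$ there is a partition $(Q,Z)$ of $I\setminus X$ with $|Z|\le k|X\setminus I|$ such that $P\cup Q\in\mathcal{I}$ for every basis $P$ of $X$. $k$-circuit bounded: for every $I\in\mathcal{I}$ and every $e\in S\setminus I$, the set $I\cup\{e\}$ contains at most $k$ distinct circuits. -}

module Defs where

open import Data.Fin.Subset using (Subset; _∉_; _⊆_; _∪_; _∩_; _─_; ⁅_⁆; ⊥; ∣_∣)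
open import Data.List.Base using (List; length)
open import Data.List.Relation.Unary.All using (All)
open import Data.List.Relation.Unary.Unique.Propositional using (Unique)
open import Data.Nat.Base using (ℕ; _≤_; _*_)
open import Data.Product.Base using (∃; ∃₂; _×_)
open import Level using (0ℓ)
open import Relation.Binary.PropositionalEquality.Core using (_≡_)
open import Relation.Nullary.Negation.Core using (¬_)
open import Relation.Unary using (Pred; Decidable)

-- The ground set is Fin n.  Membership in the family is required to be
-- decidable, as it classically always is for a family of subsets.
record IndependenceSystem (n : ℕ) : Set₁ where
  field
    Indep      : Pred (Subset n) 0ℓ
    indep?     : Decidable Indep
    nonempty   : ∃ Indep
    downClosed : ∀ {I J} → J ⊆ I → Indep I → Indep J

Minimal : ∀ {n} → Pred (Subset n) 0ℓ → Pred (Subset n) 0ℓ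
Minimal P A = P A × (∀ B → P B → B ⊆ A → B ≡ A)

Maximal : ∀ {n} → Pred (Subset n) 0ℓ → Pred (Subset n) 0ℓ
Maximal P A = P A × (∀ B → P B → A ⊆ B → B ≡ A)

-- As usual, the parts may be empty.
IsPartition : ∀ {n} → Subset n → Subset n → Subset n → Set
IsPartition A Q Z = Q ∪ Z ≡ A × Q ∩ Z ≡ ⊥

-- Every repetition-free list of subsets satisfying P has length at most k.
AtMost : ∀ {n} → ℕ → Pred (Subset n) 0ℓ → Set
AtMost {n} k P = (Cs : List (Subset n)) → Unique Cs → All P Cs → length Cs ≤ k

module _ {n : ℕ} (M : IndependenceSystem n) where
  open IndependenceSystem M

  Circuit : Pred (Subset n) 0ℓ
  Circuit = Minimal (λ C → ¬ Indep C)

  Basis : Subset n → Pred (Subset n) 0ℓ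
  Basis X = Maximal (λ P → Indep P × P ⊆ X)

  -- Q and Z are chosen before the basis P.
  Growth : ℕ → Set
  Growth k = ∀ X I → Indep I →
    ∃₂ λ Q Z → IsPartition (I ─ X) Q Z
             × ∣ Z ∣ ≤ k * ∣ X ─ I ∣
             × (∀ P → Basis X P → Indep (P ∪ Q))

  CircuitBounded : ℕ → Set
  CircuitBounded k = ∀ I → Indep I → ∀ e → e ∉ I →
    AtMost k (λ C → Circuit C × C ⊆ I ∪ ⁅ e ⁆)

{-# OPTIONS --safe #-}

-- Let e be one of k + 2 points, and call a set dependent if it contains e and
-- at least two other points.  The circuits are the triples {e , a , b}, and
-- adding e to the set of the other points creates all k(k+1)/2 > k of them.
-- For k-growth, if X ⊈ I then Z = I \ X works unless |I \ X| = k + 1; in that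
-- case |X| = 1, so P together with a single point of I \ X has at most two
-- elements and is independent, while only k points are discarded.
module Submission where

open import Defs
open import Data.Fin.Base using (Fin; zero; suc)
open import Data.Fin.Subset
  using (Subset; Empty; inside; outside; _∈_; _⊆_; _∪_; _─_; ⁅_⁆; ⊥; ⊤; ∣_∣)
open import Data.Fin.Subset.Properties
open import Data.List.Base using (List; _∷_; map; allFin)
open import Data.List.Properties using (length-map; length-tabulate)
open import Data.List.Relation.Unary.All using (All; _∷_)
import Data.List.Relation.Unary.All.Properties as All
open import Data.List.Relation.Unary.AllPairs using (_∷_)
open import Data.List.Relation.Unary.Unique.Propositional using (Unique)
import Data.List.Relation.Unary.Unique.Propositional.Properties as Unique
open import Data.Nat.Base using (ℕ; suc; _+_; _≤_; z≤n; s≤s; >-nonZero)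
open import Data.Nat.Properties
open import Data.Product.Base using (Σ; ∃; _×_; _,_)
open import Data.Sum.Base using ([_,_]′)
open import Data.Vec.Base using ([]; _∷_; here)
open import Function.Base using (_∘_; id)
open import Relation.Binary.PropositionalEquality
  using (_≡_; refl; sym; trans; cong; subst)
open import Relation.Nullary using (¬_; yes; no; contradiction; _→-dec_)

∣p∪q∣≤∣p∣+∣q∣ : ∀ {n} (p q : Subset n) → ∣ p ∪ q ∣ ≤ ∣ p ∣ + ∣ q ∣
∣p∪q∣≤∣p∣+∣q∣ []            []            = z≤n
∣p∪q∣≤∣p∣+∣q∣ (outside ∷ p) (outside ∷ q) = ∣p∪q∣≤∣p∣+∣q∣ p q
∣p∪q∣≤∣p∣+∣q∣ (outside ∷ p) (inside  ∷ q) =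
  ≤-trans (s≤s (∣p∪q∣≤∣p∣+∣q∣ p q)) (≤-reflexive (sym (+-suc ∣ p ∣ ∣ q ∣)))
∣p∪q∣≤∣p∣+∣q∣ (inside  ∷ p) (outside ∷ q) = s≤s (∣p∪q∣≤∣p∣+∣q∣ p q)
∣p∪q∣≤∣p∣+∣q∣ (inside  ∷ p) (inside  ∷ q) =
  s≤s (≤-trans (∣p∪q∣≤∣p∣+∣q∣ p q) (+-monoʳ-≤ ∣ p ∣ (n≤1+n ∣ q ∣)))

-- The two sets are disjoint. With `n` equal to k + 2, this lets the sizes of `I ─ X` and `X` bound
-- each other in the tight case of `growth`.
∣p─q∣+∣q∣≤n : ∀ {n} (p q : Subset n) → ∣ p ─ q ∣ + ∣ q ∣ ≤ n
∣p─q∣+∣q∣≤n []            []            = z≤n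
∣p─q∣+∣q∣≤n (outside ∷ p) (outside ∷ q) = m≤n⇒m≤1+n (∣p─q∣+∣q∣≤n p q)
∣p─q∣+∣q∣≤n (inside  ∷ p) (outside ∷ q) = s≤s (∣p─q∣+∣q∣≤n p q)
∣p─q∣+∣q∣≤n (_       ∷ p) (inside  ∷ q) =
  ≤-trans (≤-reflexive (+-suc ∣ p ─ q ∣ ∣ q ∣)) (s≤s (∣p─q∣+∣q∣≤n p q))

isPartition-─ : ∀ {n} {p q : Subset n} → q ⊆ p → IsPartition p q (p ─ q)
isPartition-─ {p = []}          {[]}          _   = refl , refl
isPartition-─ {p = outside ∷ p} {inside  ∷ q} q⊆p with () ← q⊆p here
isPartition-─ {p = s       ∷ p} {outside ∷ q} q⊆p
  with ∪≡ , ∩≡ ← isPartition-─ (drop-∷-⊆ q⊆p)   = cong (s ∷_) ∪≡ , cong (outside ∷_) ∩≡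
isPartition-─ {p = inside  ∷ p} {inside  ∷ q} q⊆p
  with ∪≡ , ∩≡ ← isPartition-─ (drop-∷-⊆ q⊆p)   = cong (inside ∷_) ∪≡ , cong (outside ∷_) ∩≡

x∈p⇒⁅x⁆⊆p : ∀ {n} {x} {p : Subset n} → x ∈ p → ⁅ x ⁆ ⊆ p
x∈p⇒⁅x⁆⊆p {x = x} {p} x∈p y∈⁅x⁆ = subst (_∈ p) (sym (x∈⁅y⁆⇒x≡y x y∈⁅x⁆)) x∈p

x∈p⇒1≤∣p∣ : ∀ {n} {x} {p : Subset n} → x ∈ p → 1 ≤ ∣ p ∣
x∈p⇒1≤∣p∣ {x = x} x∈p =
  ≤-trans (≤-reflexive (sym (∣⁅x⁆∣≡1 x))) (p⊆q⇒∣p∣≤∣q∣ (x∈p⇒⁅x⁆⊆p x∈p))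

p─q-empty⇒p⊆q : ∀ {n} {p q : Subset n} → Empty (p ─ q) → p ⊆ q
p─q-empty⇒p⊆q {q = q} empty {x} x∈p with x ∈? q
... | yes x∈q = x∈q
... | no  x∉q = contradiction (x , x∈p∧x∉q⇒x∈p─q x∈p x∉q) empty

p⊆q∧∣q∣≤∣p∣⇒p≡q : ∀ {n} {p q : Subset n} → p ⊆ q → ∣ q ∣ ≤ ∣ p ∣ → p ≡ q
p⊆q∧∣q∣≤∣p∣⇒p≡q {p = p} {q} p⊆q ∣q∣≤∣p∣ = ⊆-antisym p⊆q q⊆p
  where
  q⊆p : q ⊆ p
  q⊆p {x} x∈q with x ∈? p
  ... | yes x∈p = x∈p
  ... | no  x∉p = contradiction ∣q∣≤∣p∣ (<⇒≱ (p⊂q⇒∣p∣<∣q∣ (p⊆q , x , x∈q , x∉p)))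

⁅⁆-injective : ∀ {n} {x y : Fin n} → ⁅ x ⁆ ≡ ⁅ y ⁆ → x ≡ y
⁅⁆-injective {x = x} {y} eq = x∈⁅y⁆⇒x≡y y (subst (x ∈_) eq (x∈⁅x⁆ x))

-- The point e is `zero`. Stating independence as an implication makes every set that avoids `zero`
-- independent, whatever its size.
zero-in-≤2 : ∀ m → IndependenceSystem (suc m)
zero-in-≤2 m = record
  { Indep      = λ p → zero ∈ p → ∣ p ∣ ≤ 2
  ; indep?     = λ p → (zero ∈? p) →-dec (∣ p ∣ ≤? 2)
  ; nonempty   = ⊥ , λ ()
  ; downClosed = λ J⊆I I-indep 0∈J → ≤-trans (p⊆q⇒∣p∣≤∣q∣ J⊆I) (I-indep (J⊆I 0∈J))
  }

growth : ∀ k → Growth (zero-in-≤2 (suc k)) k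
growth k X I I-indep with nonempty? (X ─ I)
-- Here `X ⊆ I`, so the bound on `Z` is zero and nothing may be discarded; `P ∪ Q` stays inside `I`.
... | no X─I-empty =
  I ─ X , ⊥ , (∪-identityʳ (I ─ X) , ∩-zeroʳ (I ─ X)) ,
  ≤-trans (≤-reflexive (∣⊥∣≡0 (2 + k))) z≤n ,
  λ { P ((_ , P⊆X) , _) → downClosed (P∪[I─X]⊆I P⊆X) I-indep }
  where
  open IndependenceSystem (zero-in-≤2 (suc k))
  P∪[I─X]⊆I : ∀ {P} → P ⊆ X → P ∪ (I ─ X) ⊆ I
  P∪[I─X]⊆I {P} P⊆X =
    [ p─q-empty⇒p⊆q X─I-empty ∘ P⊆X , p─q⊆p I X ]′ ∘ x∈p∪q⁻ P (I ─ X)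
... | yes (x , x∈X─I) with ∣ I ─ X ∣ ≤? k
-- The point `x` makes the bound on `Z` at least `k`, enough to discard all of `I ─ X`.
...   | yes ∣I─X∣≤k =
  ⊥ , I ─ X , (∪-identityˡ (I ─ X) , ∩-zeroˡ (I ─ X)) ,
  ≤-trans ∣I─X∣≤k (m≤m*n k ∣ X ─ I ∣ {{>-nonZero (x∈p⇒1≤∣p∣ x∈X─I)}}) ,
  λ { P ((P-indep , _) , _) → subst Indep (sym (∪-identityʳ P)) P-indep }
  where open IndependenceSystem (zero-in-≤2 (suc k))
...   | no ∣I─X∣≰k with nonempty? (I ─ X)
...     | no I─X-empty =
  contradiction
    (≤-trans (≤-reflexive (trans (cong ∣_∣ (Empty-unique I─X-empty)) (∣⊥∣≡0 (2 + k)))) z≤n)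
    ∣I─X∣≰k
...     | yes (a , a∈I─X) =
  ⁅ a ⁆ , I ─ X ─ ⁅ a ⁆ , isPartition-─ (x∈p⇒⁅x⁆⊆p a∈I─X) ,
  -- Keeping `a` brings the discarded part from at most k + 1 points down to at most `k`.
  ≤-trans (≤-pred (≤-trans (x∈p⇒∣p-x∣<∣p∣ a∈I─X) ∣I─X∣≤1+k))
          (m≤m*n k ∣ X ─ I ∣ {{>-nonZero (x∈p⇒1≤∣p∣ x∈X─I)}}) ,
  λ { P ((_ , P⊆X) , _) _ → ∣P∪⁅a⁆∣≤2 P⊆X }
  where
  open ≤-Reasoning
  1≤∣X∣ : 1 ≤ ∣ X ∣
  1≤∣X∣ = x∈p⇒1≤∣p∣ (p─q⊆p X I x∈X─I)
  ∣I─X∣≤1+k : ∣ I ─ X ∣ ≤ suc k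
  ∣I─X∣≤1+k = ≤-pred (begin
    suc ∣ I ─ X ∣     ≡⟨ +-comm 1 ∣ I ─ X ∣ ⟩
    ∣ I ─ X ∣ + 1     ≤⟨ +-monoʳ-≤ ∣ I ─ X ∣ 1≤∣X∣ ⟩
    ∣ I ─ X ∣ + ∣ X ∣ ≤⟨ ∣p─q∣+∣q∣≤n I X ⟩
    2 + k             ∎)
  -- At least k + 1 of the k + 2 points lie in `I ─ X`, which leaves at most one for `X`.
  ∣X∣≤1 : ∣ X ∣ ≤ 1
  ∣X∣≤1 = +-cancelˡ-≤ (suc k) ∣ X ∣ 1 (begin
    suc k + ∣ X ∣     ≤⟨ +-monoˡ-≤ ∣ X ∣ (≰⇒> ∣I─X∣≰k) ⟩
    ∣ I ─ X ∣ + ∣ X ∣ ≤⟨ ∣p─q∣+∣q∣≤n I X ⟩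
    2 + k             ≡⟨ +-comm 1 (suc k) ⟩
    suc k + 1         ∎)
  ∣P∪⁅a⁆∣≤2 : ∀ {P} → P ⊆ X → ∣ P ∪ ⁅ a ⁆ ∣ ≤ 2
  ∣P∪⁅a⁆∣≤2 {P} P⊆X = begin
    ∣ P ∪ ⁅ a ⁆ ∣     ≤⟨ ∣p∪q∣≤∣p∣+∣q∣ P ⁅ a ⁆ ⟩
    ∣ P ∣ + ∣ ⁅ a ⁆ ∣ ≡⟨ cong (∣ P ∣ +_) (∣⁅x⁆∣≡1 a) ⟩
    ∣ P ∣ + 1         ≤⟨ +-monoˡ-≤ 1 (≤-trans (p⊆q⇒∣p∣≤∣q∣ P⊆X) ∣X∣≤1) ⟩
    2                 ∎

-- Sets of at most two points are independent, so a dependent subset of a triple must be the whole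
-- triple.
triple-circuit : ∀ {m} {C : Subset (suc m)} → zero ∈ C → ∣ C ∣ ≡ 3 →
                 Circuit (zero-in-≤2 m) C
triple-circuit 0∈C ∣C∣≡3 =
  (λ C-indep → contradiction (C-indep 0∈C) (<⇒≱ (≤-reflexive (sym ∣C∣≡3)))) ,
  λ B B-dep B⊆C → p⊆q∧∣q∣≤∣p∣⇒p≡q B⊆C
    (≤-trans (≤-reflexive ∣C∣≡3) (≰⇒> λ ∣B∣≤2 → B-dep λ _ → ∣B∣≤2))

-- With k = 2 + j, listing k + 1 of the circuits suffices: the `k` triples through the points 0 and
-- 1, and one more.
¬circuitBounded : ∀ j → ¬ CircuitBounded (zero-in-≤2 (3 + j)) (2 + j)
¬circuitBounded j bounded =
  1+n≰n (subst (_≤ 2 + j) length≡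
    (bounded I (λ ()) zero (λ ()) circuits unique all))
  where
  I : Subset (4 + j)
  I = outside ∷ ⊤
  through-1 : Fin (2 + j) → Subset (4 + j)
  through-1 i = inside ∷ inside ∷ ⁅ i ⁆
  avoiding-1 : Subset (4 + j)
  -- The triple {0, 2, 3} needs four points, which is where k ≥ 2 enters. It differs from the other
  -- triples at the point 1.
  avoiding-1 = inside ∷ outside ∷ inside ∷ inside ∷ ⊥
  circuits : List (Subset (4 + j))
  circuits = avoiding-1 ∷ map through-1 (allFin (2 + j))
  length≡ = cong suc (trans (length-map through-1 (allFin (2 + j))) (length-tabulate id))
  unique : Unique circuits
  unique = All.map⁺ (All.tabulate⁺ {f = id} λ _ ())
         ∷ Unique.map⁺ through-1-injective (Unique.allFin⁺ (2 + j))
    where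
    through-1-injective : ∀ {x y} → through-1 x ≡ through-1 y → x ≡ y
    through-1-injective = ⁅⁆-injective ∘ cong (λ { (_ ∷ _ ∷ p) → p })
  within : ∀ {C} → C ⊆ I ∪ ⁅ zero ⁆
  -- Adding `zero` to `I` gives the whole ground set.
  within {C} = subst (C ⊆_) (cong (inside ∷_) (sym (∪-identityʳ ⊤))) (λ _ → ∈⊤)
  all : All (λ C → Circuit (zero-in-≤2 (3 + j)) C × C ⊆ I ∪ ⁅ zero ⁆) circuits
  all = (triple-circuit here (cong (3 +_) (∣⊥∣≡0 j)) , within)
      ∷ All.map⁺ (All.tabulate⁺ {f = id} λ i →
          triple-circuit here (cong (2 +_) (∣⁅x⁆∣≡1 i)) , within)

theorem12 : (k : ℕ) → 2 ≤ k →
    ∃ λ (n : ℕ) → Σ (IndependenceSystem n) λ M → Growth M k × ¬ CircuitBounded M k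
theorem12 k@(suc (suc j)) (s≤s (s≤s _)) =
  2 + k , zero-in-≤2 (suc k) , growth k , ¬circuitBounded j
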